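{- Let $X$ be a finite set and let $\pi_X\in\Pi_l(X)$ be a labelled set partition all of whose blocks are singletons (each labelled or unlabelled). Then $\Pi_l(X,\pi_X)_0$ consists exactly of those $\pi\in\Pi_l(X,\pi_X)$ having at most one unlabelled block. Moreover, $\lambda(\pi)=\mu_{\Pi_l(X)}(\pi,\pi^*)$ for all $\pi\in\Pi_l(X,\pi_X)_0$.
   Context: For a finite set $X$ and a symbol $l\notin X$, a labelled set partition of $X$ is $\pi=\{B_1\cup L_1,\dots,B_k\cup L_k\}$ with $\{B_1,\dots,B_k\}$ a set partition of $X$ and $L_i\in\{\emptyset,\{l\}\}$ (labelled block iff $L_i=\{l\}$). $\Pi_l(X)$ is the set of these, ordered by $\sigma\le\pi$ iff every block of $\sigma$ (including $l$ if present) is contained in a block of $\pi$; $\mu_{\Pi_l(X)}$ is its Möbius function ($\mu(x,x)=1$, $\sum_{x\le z\le y}\mu(x,z)=0$ for $x<y$, $\mu(x,y)=0$ if $x\not\le y$). $m(\pi)=1$ if $\pi$ has exactly one labelled block, else $0$. $\Pi_l(X,\pi_X)=\{\pi\in\Pi_l(X):\pi\ge\pi_X,\ \pi\text{ has at least one labelled block}\}$. For $\pi\in\Pi_l(X,\pi_X)$, $\lambda(\pi)=\sum_{\sigma\in\Pi_l(X,\pi_X),\sigma\ge\pi}\mu_{\Pi_l(X)}(\pi,\sigma)m(\sigma)$, and $\Pi_l(X,\pi_X)_0=\{\pi\in\Pi_l(X,\pi_X):\lambda(\pi)\ne0\}$. For $\pi\in\Pi_l(X,\pi_X)$, $\pi^*$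 is the labelled set partition obtained from $\pi$ by uniting all its labelled blocks into a single labelled block (unlabelled blocks unchanged). -}

module Defs where

open import Data.Bool using (Bool; true; false; _∧_; _∨_; not; if_then_else_)
open import Data.Nat using (ℕ; zero; suc; _<ᵇ_)
open import Data.Fin using (Fin; toℕ)
open import Data.List using (List; []; _∷_; map; concatMap; filter; allFin; foldr; length; cartesianProductWith)
open import Data.Vec using (Vec; []; _∷_; lookup)
open import Data.Product using (_×_; _,_; proj₁; proj₂)
open import Data.Integer using (ℤ; _+_; _*_; +_; 0ℤ; 1ℤ)
open import Relation.Binary.PropositionalEquality using (_≡_)
open import Relation.Nullary using (¬_)

-- Labelled set partitions of X = Fin n.
-- A (raw) labelled partition is an n×n Boolean matrix (the equivalence
-- relation "i and j lie in the same block") together with a Boolean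
-- per element ("the block of i is labelled", i.e. contains l).
-- Validity (below) says the matrix is an equivalence relation and the
-- label is constant on blocks.  Valid raw data correspond bijectively to
-- the elements of Π_l(X).

Raw : ℕ → Set
Raw n = Vec (Vec Bool n) n × Vec Bool n

rel : ∀ {n} → Raw n → Fin n → Fin n → Bool
rel (r , _) i j = lookup (lookup r i) j

lab : ∀ {n} → Raw n → Fin n → Bool
lab (_ , l) i = lookup l i

_⇒ᵇ_ : Bool → Bool → Bool
a ⇒ᵇ b = not a ∨ b

_==ᵇ_ : Bool → Bool → Bool
a ==ᵇ b = (a ⇒ᵇ b) ∧ (b ⇒ᵇ a)

∀Fin : ∀ n → (Fin n → Bool) → Bool
∀Fin n p = foldr (λ i b → p i ∧ b) true (allFin n)

valid : ∀ {n} → Raw n → Bool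
valid {n} π =
  ∀Fin n (λ i → rel π i i) ∧
  ∀Fin n (λ i → ∀Fin n (λ j → rel π i j ⇒ᵇ rel π j i)) ∧
  ∀Fin n (λ i → ∀Fin n (λ j → ∀Fin n (λ k → (rel π i j ∧ rel π j k) ⇒ᵇ rel π i k))) ∧
  ∀Fin n (λ i → ∀Fin n (λ j → rel π i j ⇒ᵇ (lab π i ==ᵇ lab π j)))

leq : ∀ {n} → Raw n → Raw n → Bool
leq {n} σ π =
  ∀Fin n (λ i → ∀Fin n (λ j → rel σ i j ⇒ᵇ rel π i j)) ∧
  ∀Fin n (λ i → lab σ i ⇒ᵇ lab π i)

vecs : ∀ {A : Set} → List A → (n : ℕ) → List (Vec A n)
vecs xs zero = [] ∷ []
vecs xs (suc n) = concatMap (λ x → map (x ∷_) (vecs xs n)) xs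

bools : List Bool
bools = false ∷ true ∷ []

allRaw : ∀ n → List (Raw n)
allRaw n = cartesianProductWith _,_ (vecs (vecs bools n) n) (vecs bools n)

-- Π_l(Fin n), each element listed exactly once.
ΠL : ∀ n → List (Raw n)
ΠL n = filter (λ π → Data.Bool._≟_ (valid π) true) (allRaw n)
  where import Data.Bool

sumℤ : ∀ {A : Set} → (A → ℤ) → List A → ℤ
sumℤ f = foldr (λ a s → f a + s) 0ℤ

ΣΠ : ∀ {n} → (Raw n → Bool) → (Raw n → ℤ) → ℤ
ΣΠ {n} p f = sumℤ (λ z → if p z then f z else 0ℤ) (ΠL n)

-- Möbius function of Π_l(Fin n): μ is characterised by its defining
-- equations on valid elements (this determines μ uniquely there).
record IsMobius {n} (μ : Raw n → Raw n → ℤ) : Set where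
  field
    μ-refl : ∀ x → valid x ≡ true → μ x x ≡ 1ℤ
    μ-sum  : ∀ x y → valid x ≡ true → valid y ≡ true → leq x y ≡ true → ¬ (x ≡ y) →
             ΣΠ (λ z → leq x z ∧ leq z y) (λ z → μ x z) ≡ 0ℤ
    μ-zero : ∀ x y → valid x ≡ true → valid y ≡ true → leq x y ≡ false → μ x y ≡ 0ℤ

-- Blocks are counted via their least element.
isMin : ∀ {n} → Raw n → Fin n → Bool
isMin {n} π i = ∀Fin n (λ j → (toℕ j <ᵇ toℕ i) ⇒ᵇ not (rel π j i))

count : ∀ n → (Fin n → Bool) → ℕ
count n p = length (filter (λ i → Data.Bool._≟_ (p i) true) (allFin n))
  where import Data.Bool

labBlocks : ∀ {n} → Raw n → ℕ
labBlocks {n} π = count n (λ i → isMin π i ∧ lab π i)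

unlabBlocks : ∀ {n} → Raw n → ℕ
unlabBlocks {n} π = count n (λ i → isMin π i ∧ not (lab π i))

m : ∀ {n} → Raw n → ℤ
m π with labBlocks π
... | 1 = 1ℤ
... | _ = 0ℤ

inΠᵇ : ∀ {n} → Raw n → Raw n → Bool
inΠᵇ πX π = valid π ∧ leq πX π ∧ (0 <ᵇ labBlocks π)

lam : ∀ {n} → (Raw n → Raw n → ℤ) → Raw n → Raw n → ℤ
lam μ πX π = ΣΠ (λ σ → inΠᵇ πX σ ∧ leq π σ) (λ σ → μ π σ * m σ)

star : ∀ {n} → Raw n → Raw n
star {n} π = Data.Vec.tabulate (λ i → Data.Vec.tabulate (λ j → rel π i j ∨ (lab π i ∧ lab π j))) , proj₂ π
  where import Data.Vec

singletons : ∀ {n} → Raw n → Set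
singletons {n} π = ∀ (i j : Fin n) → rel π i j ≡ true → i ≡ j

{-# OPTIONS --safe #-}

-- Everything rests on Rota's closure theorem: if π is not closed under a closure operator cl,
-- then Σ μ(π,z) over the z ≥ π with cl z = y vanishes for every y.
--
-- Labelling the block of b: if b is unlabelled in π and y joins b to a labelled block of π, then
-- the fibre over y is {y}, so μ(π,y) = 0.  Hence only those σ contribute to λ(π) whose single
-- labelled block is exactly the union of the labelled blocks of π.
--
-- Merging the blocks of p and q: if p, q lie in different unlabelled blocks of π, the set of
-- contributing σ is a union of fibres, so λ(π) = 0.  If π has at most one unlabelled block, π* is
-- the only contributing σ, so λ(π) = μ(π,π*).
--
-- For p, q in the same block of y but not of π, every z ≠ y in the fibre over y has one block more
-- than y, so by induction all these μ(π,z) have the same sign and μ(π,y) has the opposite one.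
-- This gives (-1)^(|π| + |y|) μ(π,y) > 0 when y ≥ π has the same labelled elements; take y = π*.
module Submission where

open import Defs
open import Data.Bool using (Bool; true; false; _∧_; _∨_; not; if_then_else_)
import Data.Bool as Bool
open import Data.Bool.Properties using (∧-conicalˡ; ∧-conicalʳ; ¬-not)
open import Data.Fin using (Fin; toℕ)
import Data.Fin.Properties as Fin
open import Data.Integer using (ℤ; _+_; _*_; -_; 0ℤ; 1ℤ)
import Data.Integer as ℤ
import Data.Integer.Properties as ℤ
open import Data.List using (_++_; List; []; _∷_; map; concatMap; filter; allFin; foldr; length; cartesianProductWith)
open import Data.List.Membership.Propositional using (_∈_)
open import Data.List.Membership.Propositional.Properties
  using (∈-allFin; ∈-filter⁺; ∈-filter⁻; ∈-cartesianProductWith⁺)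
open import Data.List.Relation.Unary.All using ([]; _∷_)
import Data.List.Relation.Unary.All as All
open import Data.List.Relation.Unary.AllPairs using ([]; _∷_)
open import Data.List.Relation.Unary.Any using (here; there)
open import Data.List.Relation.Unary.Unique.Propositional using (Unique)
import Data.List.Relation.Unary.Unique.Propositional.Properties as Unique
open import Data.Nat using (ℕ; zero; suc; _≤_; _<_; z≤n; s≤s; _<ᵇ_)
import Data.Nat.Properties as ℕ
open import Data.Nat.Induction using (<-wellFounded)
open import Data.Product using (_×_; _,_; proj₁; proj₂; ∃)
import Data.Product.Properties as Product
open import Data.Sum using (_⊎_; inj₁; inj₂; [_,_]′)
open import Data.Vec using (Vec; []; _∷_; lookup; tabulate)
import Data.Vec.Properties as Vec
open import Function using (_∘_; case_of_; const)
open import Function.Bundles using (_⇔_; mk⇔; Equivalence)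
open import Induction.WellFounded using (Acc; acc)
open import Relation.Binary.Definitions using (tri<; tri≈; tri>)
open import Relation.Binary.PropositionalEquality
open import Relation.Nullary using (¬_; Dec; yes; no; does; contradiction)
import Relation.Nullary.Decidable as Dec
open import Relation.Nullary.Decidable using (_×-dec_; _⊎-dec_; _→-dec_; dec-true; dec-false; decidable-stable)

open Equivalence using (to; from)

-- Booleans and finite lists

bool-ext : ∀ {a b} → (a ≡ true → b ≡ true) → (b ≡ true → a ≡ true) → a ≡ b
bool-ext {false} {false} f g = refl
bool-ext {false} {true}  f g = g refl
bool-ext {true}  {false} f g = sym (f refl)
bool-ext {true}  {true}  f g = refl

∧-intro : ∀ {a b} → a ≡ true → b ≡ true → a ∧ b ≡ true
∧-intro refl refl = refl

⇒ᵇ⇔ : ∀ {a b} → (a ⇒ᵇ b) ≡ true ⇔ (a ≡ true → b ≡ true)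
⇒ᵇ⇔ {false} = mk⇔ (λ _ ()) (λ _ → refl)
⇒ᵇ⇔ {true}  = mk⇔ (λ e _ → e) (λ f → f refl)

not⇔ : ∀ {a} → not a ≡ true ⇔ (¬ a ≡ true)
not⇔ {false} = mk⇔ (λ _ ()) (λ _ → refl)
not⇔ {true}  = mk⇔ (λ ()) (λ f → contradiction refl f)

does⇔ : ∀ {a} {A : Set a} (A? : Dec A) → does A? ≡ true ⇔ A
does⇔ A?@(yes x) = mk⇔ (λ _ → x) (λ _ → refl)
does⇔ A?@(no ¬x) = mk⇔ (λ ()) (λ x → contradiction x ¬x)

<ᵇ⇔ : ∀ {m n} → (m <ᵇ n) ≡ true ⇔ m < n
<ᵇ⇔ {m} {n} = mk⇔ (λ e → ℕ.<ᵇ⇒< m n (subst Bool.T (sym e) _)) (λ m<n → T⇒true (ℕ.<⇒<ᵇ m<n))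
  where
  T⇒true : ∀ {b} → Bool.T b → b ≡ true
  T⇒true {true} _ = refl

∀Fin⇔ : ∀ {n} (p : Fin n → Bool) → ∀Fin n p ≡ true ⇔ (∀ i → p i ≡ true)
∀Fin⇔ {n} p = mk⇔ (λ e i → list⁻ (allFin n) e (∈-allFin i)) (λ f → list⁺ f (allFin n))
  where
  list⁻ : ∀ {i} xs → foldr (λ i b → p i ∧ b) true xs ≡ true → i ∈ xs → p i ≡ true
  list⁻ (x ∷ xs) e (here refl) = ∧-conicalˡ _ _ e
  list⁻ (x ∷ xs) e (there i∈)  = list⁻ xs (∧-conicalʳ (p x) _ e) i∈
  list⁺ : (∀ i → p i ≡ true) → ∀ xs → foldr (λ i b → p i ∧ b) true xs ≡ true
  list⁺ f []       = refl
  list⁺ f (x ∷ xs) = ∧-intro (f x) (list⁺ f xs)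

∀Fin²⇔ : ∀ {n} (p : Fin n → Fin n → Bool) →
         ∀Fin n (λ i → ∀Fin n (p i)) ≡ true ⇔ (∀ i j → p i j ≡ true)
∀Fin²⇔ {n} p = mk⇔
  (λ e i → to (∀Fin⇔ (p i)) (to (∀Fin⇔ (λ i → ∀Fin n (p i))) e i))
  (λ f → from (∀Fin⇔ (λ i → ∀Fin n (p i))) λ i → from (∀Fin⇔ (p i)) (f i))

∀Fin³⇔ : ∀ {n} (p : Fin n → Fin n → Fin n → Bool) →
         ∀Fin n (λ i → ∀Fin n (λ j → ∀Fin n (p i j))) ≡ true ⇔ (∀ i j k → p i j k ≡ true)
∀Fin³⇔ {n} p = mk⇔
  (λ e i → to (∀Fin²⇔ (p i)) (to (∀Fin⇔ (λ i → ∀Fin n (λ j → ∀Fin n (p i j)))) e i))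
  (λ f → from (∀Fin⇔ (λ i → ∀Fin n (λ j → ∀Fin n (p i j)))) λ i → from (∀Fin²⇔ (p i)) (f i))

module _ {A : Set} where

  length≤1⇒≡ : {xs : List A} → length xs ≤ 1 → ∀ {x y} → x ∈ xs → y ∈ xs → x ≡ y
  length≤1⇒≡ {_ ∷ []}    _            (here refl) (here refl) = refl
  length≤1⇒≡ {_ ∷ _ ∷ _} (s≤s ())

  length>0⇒∈ : (xs : List A) → 0 < length xs → ∃ (_∈ xs)
  length>0⇒∈ (x ∷ _) _ = x , here refl

  ∈⇒length>0 : {xs : List A} {x : A} → x ∈ xs → 0 < length xs
  ∈⇒length>0 (here _)  = s≤s z≤n
  ∈⇒length>0 (there _) = s≤s z≤n

  ≡⇒length≤1 : {xs : List A} → Unique xs → (∀ {x y} → x ∈ xs → y ∈ xs → x ≡ y) → length xs ≤ 1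
  ≡⇒length≤1 {[]}        _                 _ = z≤n
  ≡⇒length≤1 {_ ∷ []}    _                 _ = s≤s z≤n
  ≡⇒length≤1 {_ ∷ _ ∷ _} ((x≢y ∷ _) ∷ _) h =
    contradiction (h (here refl) (there (here refl))) x≢y

  countᵇ : (A → Bool) → List A → ℕ
  countᵇ p xs = length (filter (λ x → p x Bool.≟ true) xs)

  countᵇ-cong : ∀ {p q} {xs : List A} → (∀ {x} → x ∈ xs → p x ≡ q x) → countᵇ p xs ≡ countᵇ q xs
  countᵇ-cong {xs = []} h = refl
  countᵇ-cong {p} {q} {x ∷ xs} h with p x | q x | h (here refl)
  ... | true  | _ | refl = cong suc (countᵇ-cong {p} {q} {xs} (h ∘ there))
  ... | false | _ | refl = countᵇ-cong {p} {q} {xs} (h ∘ there)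

  countᵇ-mono : ∀ {p q} {xs : List A} → (∀ {x} → x ∈ xs → p x ≡ true → q x ≡ true) →
                countᵇ p xs ≤ countᵇ q xs
  countᵇ-mono {xs = []} h = z≤n
  countᵇ-mono {p} {q} {x ∷ xs} h with p x | q x | h (here refl)
  ... | true  | true  | _ = s≤s (countᵇ-mono {p} {q} {xs} (h ∘ there))
  ... | true  | false | f = case f refl of λ ()
  ... | false | true  | _ = ℕ.m≤n⇒m≤1+n (countᵇ-mono {p} {q} {xs} (h ∘ there))
  ... | false | false | _ = countᵇ-mono {p} {q} {xs} (h ∘ there)

  countᵇ-strict : ∀ {p q} {xs : List A} {y} → (∀ {x} → x ∈ xs → p x ≡ true → q x ≡ true) →
                  y ∈ xs → p y ≡ false → q y ≡ true → countᵇ p xs < countᵇ q xs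
  countᵇ-strict {p} {q} {x ∷ xs} h (here refl) py qy rewrite py | qy =
    s≤s (countᵇ-mono {p} {q} {xs} (h ∘ there))
  countᵇ-strict {p} {q} {x ∷ xs} h (there y∈) py qy with p x | q x | h (here refl)
  ... | true  | true  | _ = s≤s (countᵇ-strict {p} {q} {xs} (h ∘ there) y∈ py qy)
  ... | true  | false | f = case f refl of λ ()
  ... | false | true  | _ = ℕ.m≤n⇒m≤1+n (countᵇ-strict {p} {q} {xs} (h ∘ there) y∈ py qy)
  ... | false | false | _ = countᵇ-strict {p} {q} {xs} (h ∘ there) y∈ py qy

  -- Serves to show that a merge loses exactly one block: `p` and `q` become minimality before and
  -- after the merge, and `y` the one minimum that disappears.
  countᵇ-remove : ∀ {p q} {xs : List A} {y} → Unique xs → y ∈ xs → p y ≡ true → q y ≡ false →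
                  (∀ {x} → x ≢ y → p x ≡ q x) → countᵇ p xs ≡ suc (countᵇ q xs)
  countᵇ-remove {p} {q} {x ∷ xs} (x∉ ∷ _) (here refl) py qy h rewrite py | qy =
    cong suc (countᵇ-cong {p} {q} {xs} λ z∈ → h (≢-sym (All.lookup x∉ z∈)))
  countᵇ-remove {p} {q} {x ∷ xs} (x∉ ∷ xs!) (there y∈) py qy h
    with p x | q x | h (All.lookup x∉ y∈)
  ... | true  | _ | refl = cong suc (countᵇ-remove {p} {q} xs! y∈ py qy h)
  ... | false | _ | refl = countᵇ-remove {p} {q} xs! y∈ py qy h

-- Sums of integers

module _ {A : Set} where

  sum-cong : {f g : A → ℤ} (xs : List A) → (∀ {x} → x ∈ xs → f x ≡ g x) → sumℤ f xs ≡ sumℤ g xs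
  sum-cong []       h = refl
  sum-cong (x ∷ xs) h = cong₂ _+_ (h (here refl)) (sum-cong xs (h ∘ there))

  sum-zero : {f : A → ℤ} (xs : List A) → (∀ {x} → x ∈ xs → f x ≡ 0ℤ) → sumℤ f xs ≡ 0ℤ
  sum-zero []       h = refl
  sum-zero (x ∷ xs) h = cong₂ _+_ (h (here refl)) (sum-zero xs (h ∘ there))

  sum-single : {f : A → ℤ} {xs : List A} {y : A} → Unique xs → y ∈ xs →
               (∀ {x} → x ∈ xs → x ≢ y → f x ≡ 0ℤ) → sumℤ f xs ≡ f y
  sum-single {f} {x ∷ xs} (x∉ ∷ _) (here refl) h =
    trans (cong (f x +_) (sum-zero xs λ z∈ → h (there z∈) (≢-sym (All.lookup x∉ z∈)))) (ℤ.+-identityʳ _)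
  sum-single {f} {x ∷ xs} (x∉ ∷ xs!) (there y∈) h =
    trans (cong₂ _+_ (h (here refl) (All.lookup x∉ y∈)) (sum-single xs! y∈ (h ∘ there))) (ℤ.+-identityˡ _)

  sum-+ : (f g : A → ℤ) (xs : List A) → sumℤ (λ x → f x + g x) xs ≡ sumℤ f xs + sumℤ g xs
  sum-+ f g []       = refl
  sum-+ f g (x ∷ xs) = trans (cong (f x + g x +_) (sum-+ f g xs)) (interchange (f x) (g x) _ _)
    where
    open import Algebra.Properties.CommutativeSemigroup ℤ.+-commutativeSemigroup using (interchange)

  sum-* : (a : ℤ) (f : A → ℤ) (xs : List A) → sumℤ (λ x → a * f x) xs ≡ a * sumℤ f xs
  sum-* a f []       = sym (ℤ.*-zeroʳ a)
  sum-* a f (x ∷ xs) = trans (cong (a * f x +_) (sum-* a f xs)) (sym (ℤ.*-distribˡ-+ a _ _))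

  sum-nonpos : {f : A → ℤ} (xs : List A) → (∀ {x} → x ∈ xs → f x ℤ.≤ 0ℤ) → sumℤ f xs ℤ.≤ 0ℤ
  sum-nonpos []       h = ℤ.≤-refl
  sum-nonpos (x ∷ xs) h = ℤ.+-mono-≤ (h (here refl)) (sum-nonpos xs (h ∘ there))

  sum-neg : {f : A → ℤ} {xs : List A} {y : A} → (∀ {x} → x ∈ xs → f x ℤ.≤ 0ℤ) →
            y ∈ xs → f y ℤ.< 0ℤ → sumℤ f xs ℤ.< 0ℤ
  sum-neg {xs = x ∷ xs} h (here refl) fy = ℤ.+-mono-<-≤ fy (sum-nonpos xs (h ∘ there))
  sum-neg {xs = x ∷ xs} h (there y∈)  fy = ℤ.+-mono-≤-< (h (here refl)) (sum-neg (h ∘ there) y∈ fy)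

sum-swap : {A B : Set} (f : A → B → ℤ) (xs : List A) (ys : List B) →
           sumℤ (λ x → sumℤ (f x) ys) xs ≡ sumℤ (λ y → sumℤ (λ x → f x y) xs) ys
sum-swap f []       ys = sym (sum-zero ys λ _ → refl)
sum-swap f (x ∷ xs) ys =
  trans (cong (sumℤ (f x) ys +_) (sum-swap f xs ys)) (sym (sum-+ (f x) (λ y → sumℤ (λ x → f x y) xs) ys))

-- Sums guarded by decidable conditions

when : {P : Set} → Dec P → ℤ → ℤ
when P? a = if does P? then a else 0ℤ

when-yes : {P : Set} (P? : Dec P) {a : ℤ} → P → when P? a ≡ a
when-yes P? p rewrite dec-true P? p = refl

when-no : {P : Set} (P? : Dec P) {a : ℤ} → ¬ P → when P? a ≡ 0ℤ
when-no P? ¬p rewrite dec-false P? ¬p = refl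

when-zero : {P : Set} (P? : Dec P) → when P? 0ℤ ≡ 0ℤ
when-zero P? with does P?
... | true  = refl
... | false = refl

when-sum : {P A : Set} (P? : Dec P) (f : A → ℤ) (xs : List A) →
         when P? (sumℤ f xs) ≡ sumℤ (λ x → when P? (f x)) xs
when-sum P? f xs with does P?
... | true  = refl
... | false = sym (sum-zero xs λ _ → refl)

when-⇔ : {P Q : Set} (P? : Dec P) (Q? : Dec Q) {a b : ℤ} → P ⇔ Q → (P → a ≡ b) → when P? a ≡ when Q? b
when-⇔ P? Q? P⇔Q a≡b with P?
... | yes p rewrite dec-true Q? (to P⇔Q p) = a≡b p
... | no ¬p rewrite dec-false Q? (¬p ∘ from P⇔Q) = refl

-- Labelled partitions

Rel : ∀ {n} → Raw n → Fin n → Fin n → Set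
Rel z i j = rel z i j ≡ true

Lab : ∀ {n} → Raw n → Fin n → Set
Lab z i = lab z i ≡ true

rel? : ∀ {n} (z : Raw n) i j → Dec (Rel z i j)
rel? z i j = rel z i j Bool.≟ true

lab? : ∀ {n} (z : Raw n) i → Dec (Lab z i)
lab? z i = lab z i Bool.≟ true

-- The Boolean test asks for equal labels on related elements. The implication `~-lab` carries the
-- same information, its converse coming from `~-sym`.
record Valid {n} (z : Raw n) : Set where
  field
    ~-refl  : ∀ {i} → Rel z i i
    ~-sym   : ∀ {i j} → Rel z i j → Rel z j i
    ~-trans : ∀ {i j k} → Rel z i j → Rel z j k → Rel z i k
    ~-lab   : ∀ {i j} → Rel z i j → Lab z i → Lab z j

open Valid

valid⇔ : ∀ {n} {z : Raw n} → valid z ≡ true ⇔ Valid z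
valid⇔ {n} {z} = mk⇔
  (λ e → let e₁ = ∧-conicalʳ reflᵇ _ e; e₂ = ∧-conicalʳ symᵇ _ e₁; e₃ = ∧-conicalʳ transᵇ _ e₂ in record
    { ~-refl  = to refl⇔ (∧-conicalˡ _ _ e) _
    ; ~-sym   = to ⇒ᵇ⇔ (to sym⇔ (∧-conicalˡ _ _ e₁) _ _)
    ; ~-trans = λ p q → to ⇒ᵇ⇔ (to trans⇔ (∧-conicalˡ _ _ e₂) _ _ _) (∧-intro p q)
    ; ~-lab   = λ p → to ⇒ᵇ⇔ (∧-conicalˡ _ _ (to ⇒ᵇ⇔ (to lab⇔ e₃ _ _) p))
    })
  (λ v → ∧-intro (from refl⇔ λ _ → ~-refl v)
        (∧-intro (from sym⇔ λ _ _ → from ⇒ᵇ⇔ (~-sym v))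
        (∧-intro (from trans⇔ λ i j k → from ⇒ᵇ⇔ λ e →
                   ~-trans v (∧-conicalˡ _ _ e) (∧-conicalʳ (rel z i j) _ e))
                 (from lab⇔ λ _ _ → from ⇒ᵇ⇔ λ p →
                   ∧-intro (from ⇒ᵇ⇔ (~-lab v p)) (from ⇒ᵇ⇔ (~-lab v (~-sym v p)))))))
  where
  reflᵇ  = ∀Fin n (λ i → rel z i i)
  symᵇ   = ∀Fin n (λ i → ∀Fin n (λ j → rel z i j ⇒ᵇ rel z j i))
  transᵇ = ∀Fin n (λ i → ∀Fin n (λ j → ∀Fin n (λ k → (rel z i j ∧ rel z j k) ⇒ᵇ rel z i k)))
  refl⇔  = ∀Fin⇔ (λ i → rel z i i)
  sym⇔   = ∀Fin²⇔ (λ i j → rel z i j ⇒ᵇ rel z j i)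
  trans⇔ = ∀Fin³⇔ (λ i j k → (rel z i j ∧ rel z j k) ⇒ᵇ rel z i k)
  lab⇔   = ∀Fin²⇔ (λ i j → rel z i j ⇒ᵇ (lab z i ==ᵇ lab z j))

infix 4 _⊑_ _⊑?_ _≟ᴿ_

record _⊑_ {n} (σ π : Raw n) : Set where
  constructor ⊑-intro
  field
    ⊑-rel : ∀ {i j} → Rel σ i j → Rel π i j
    ⊑-lab : ∀ {i} → Lab σ i → Lab π i

open _⊑_

leq⇔ : ∀ {n} {σ π : Raw n} → leq σ π ≡ true ⇔ σ ⊑ π
leq⇔ {n} {σ} {π} = mk⇔
  (λ e → ⊑-intro (to ⇒ᵇ⇔ (to rel⇔ (∧-conicalˡ _ _ e) _ _))
                 (to ⇒ᵇ⇔ (to lab⇔ (∧-conicalʳ relᵇ _ e) _)))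
  (λ le → ∧-intro (from rel⇔ λ _ _ → from ⇒ᵇ⇔ (⊑-rel le)) (from lab⇔ λ _ → from ⇒ᵇ⇔ (⊑-lab le)))
  where
  relᵇ = ∀Fin n (λ i → ∀Fin n (λ j → rel σ i j ⇒ᵇ rel π i j))
  rel⇔ = ∀Fin²⇔ (λ i j → rel σ i j ⇒ᵇ rel π i j)
  lab⇔ = ∀Fin⇔ (λ i → lab σ i ⇒ᵇ lab π i)

-- Abstract, so that `when (x ⊑? z)` is not unfolded into Boolean folds.
abstract
  _⊑?_ : ∀ {n} (σ π : Raw n) → Dec (σ ⊑ π)
  σ ⊑? π = Dec.map leq⇔ (leq σ π Bool.≟ true)

  _≟ᴿ_ : ∀ {n} (σ π : Raw n) → Dec (σ ≡ π)
  _≟ᴿ_ = Product.≡-dec (Vec.≡-dec (Vec.≡-dec Bool._≟_)) (Vec.≡-dec Bool._≟_)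

⊑-refl : ∀ {n} {z : Raw n} → z ⊑ z
⊑-refl = ⊑-intro (λ e → e) (λ e → e)

⊑-trans : ∀ {n} {x y z : Raw n} → x ⊑ y → y ⊑ z → x ⊑ z
⊑-trans p q = ⊑-intro (⊑-rel q ∘ ⊑-rel p) (⊑-lab q ∘ ⊑-lab p)

lookup-ext : ∀ {A : Set} {n} {xs ys : Vec A n} → (∀ i → lookup xs i ≡ lookup ys i) → xs ≡ ys
lookup-ext {xs = xs} {ys} h =
  trans (sym (Vec.tabulate∘lookup xs)) (trans (Vec.tabulate-cong h) (Vec.tabulate∘lookup ys))

⊑-antisym : ∀ {n} {x y : Raw n} → x ⊑ y → y ⊑ x → x ≡ y
⊑-antisym p q = cong₂ _,_
  (lookup-ext λ _ → lookup-ext λ _ → bool-ext (⊑-rel p) (⊑-rel q))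
  (lookup-ext λ _ → bool-ext (⊑-lab p) (⊑-lab q))

-- Enumeration of labelled partitions and the size of a down-set

vecs-suc : ∀ {A : Set} (xs : List A) n → vecs xs (suc n) ≡ cartesianProductWith _∷_ xs (vecs xs n)
vecs-suc xs n = go xs
  where
  -- The list being traversed is kept apart from the `xs` inside `vecs xs n`, so that the induction
  -- shrinks only the former.
  go : ∀ ys → concatMap (λ x → map (x ∷_) (vecs xs n)) ys ≡ cartesianProductWith _∷_ ys (vecs xs n)
  go []       = refl
  go (y ∷ ys) = cong (map (y ∷_) (vecs xs n) ++_) (go ys)

∈-vecs : ∀ {A : Set} {xs : List A} → (∀ x → x ∈ xs) → ∀ {n} (v : Vec A n) → v ∈ vecs xs n
∈-vecs h []      = here refl
∈-vecs {xs = xs} h {suc n} (x ∷ v) =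
  subst (x ∷ v ∈_) (sym (vecs-suc xs n)) (∈-cartesianProductWith⁺ _∷_ (h x) (∈-vecs h v))

vecs-unique : ∀ {A : Set} {xs : List A} → Unique xs → ∀ n → Unique (vecs xs n)
vecs-unique xs! zero    = [] ∷ []
vecs-unique {xs = xs} xs! (suc n) = subst Unique (sym (vecs-suc xs n))
  (Unique.cartesianProductWith⁺ _∷_ Vec.∷-injective xs! (vecs-unique xs! n))

∈-bools : ∀ b → b ∈ bools
∈-bools false = here refl
∈-bools true  = there (here refl)

bools-unique : Unique bools
bools-unique = ((λ ()) ∷ []) ∷ [] ∷ []

∈ΠL⇔ : ∀ {n} {z : Raw n} → z ∈ ΠL n ⇔ Valid z
∈ΠL⇔ {n} {r , l} = mk⇔
  (λ z∈ → to valid⇔ (proj₂ (∈-filter⁻ (λ π → valid π Bool.≟ true) {xs = allRaw n} z∈)))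
  (λ v → ∈-filter⁺ (λ π → valid π Bool.≟ true)
    (∈-cartesianProductWith⁺ _,_ (∈-vecs (∈-vecs ∈-bools) r) (∈-vecs ∈-bools l)) (from valid⇔ v))

ΠL-unique : ∀ n → Unique (ΠL n)
ΠL-unique n = Unique.filter⁺ (λ π → valid π Bool.≟ true)
  (Unique.cartesianProductWith⁺ _,_ Product.,-injective
    (vecs-unique (vecs-unique bools-unique n) n) (vecs-unique bools-unique n))

Sum : ∀ {n} → (Raw n → ℤ) → ℤ
Sum {n} f = sumℤ f (ΠL n)

Sum-cong : ∀ {n} {f g : Raw n → ℤ} → (∀ {z} → Valid z → f z ≡ g z) → Sum f ≡ Sum g
Sum-cong h = sum-cong (ΠL _) (h ∘ to ∈ΠL⇔)

Sum-single : ∀ {n} {f : Raw n → ℤ} {y} → Valid y → (∀ {z} → Valid z → z ≢ y → f z ≡ 0ℤ) → Sum f ≡ f y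
Sum-single vy h = sum-single (ΠL-unique _) (from ∈ΠL⇔ vy) (h ∘ to ∈ΠL⇔)

size : ∀ {n} → Raw n → ℕ
size {n} y = countᵇ (λ z → leq z y) (ΠL n)

-- By antisymmetry `y` lies in its own down-set but not in that of `x`. This makes `size` a measure
-- for well-founded induction along the order.
size-strict : ∀ {n} {x y : Raw n} → Valid y → x ⊑ y → x ≢ y → size x < size y
size-strict {x = x} {y} vy x⊑y x≢y =
  countᵇ-strict {p = λ z → leq z x} {λ z → leq z y} {y = y}
    (λ {z} _ e → from leq⇔ (⊑-trans (to (leq⇔ {σ = z}) e) x⊑y)) (from ∈ΠL⇔ vy)
    (¬-not λ e → x≢y (⊑-antisym x⊑y (to leq⇔ e))) (from (leq⇔ {σ = y} {y}) ⊑-refl)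

-- Closure operators

-- The laws concern valid data only, since arbitrary matrices need not be equivalence relations.
-- `Closed` is a predicate of its own so that it can be a plain condition such as `Lab z b` or
-- `Rel z p q`; on valid data it amounts to being fixed by `cl`. Monotonicity and idempotence are
-- consequences of `cl-least`.
record Closure (n : ℕ) : Set₁ where
  field
    cl        : Raw n → Raw n
    Closed    : Raw n → Set
    cl-valid  : ∀ {z} → Valid z → Valid (cl z)
    cl-closed : ∀ {z} → Valid z → Closed (cl z)
    cl-⊒      : ∀ {z} → Valid z → z ⊑ cl z
    cl-least  : ∀ {z y} → Valid z → Valid y → z ⊑ y → Closed y → cl z ⊑ y

  cl-id : ∀ {z} → Valid z → Closed z → cl z ≡ z
  cl-id vz cz = ⊑-antisym (cl-least vz vz ⊑-refl cz) (cl-⊒ vz)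

module _ {n} {R : Fin n → Fin n → Set} {L : Fin n → Set}
         (R? : ∀ i j → Dec (R i j)) (L? : ∀ i → Dec (L i)) where

  fromDec : Raw n
  fromDec = tabulate (λ i → tabulate (λ j → does (R? i j))) , tabulate (λ i → does (L? i))

  rel-fromDec : ∀ {i j} → Rel fromDec i j ⇔ R i j
  rel-fromDec {i} {j}
    rewrite Vec.lookup∘tabulate (λ i → tabulate (λ j → does (R? i j))) i
          | Vec.lookup∘tabulate (λ j → does (R? i j)) j = does⇔ (R? i j)

  lab-fromDec : ∀ {i} → Lab fromDec i ⇔ L i
  lab-fromDec {i} rewrite Vec.lookup∘tabulate (λ i → does (L? i)) i = does⇔ (L? i)

-- Labelling the block of one element

module _ {n} (b : Fin n) (z : Raw n) where

  labelledLab? : ∀ i → Dec (Lab z i ⊎ Rel z i b)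
  labelledLab? i = lab? z i ⊎-dec rel? z i b

  label : Raw n
  label = fromDec (rel? z) labelledLab?

  rel-label : ∀ {i j} → Rel label i j ⇔ Rel z i j
  rel-label = rel-fromDec (rel? z) labelledLab?

  lab-label : ∀ {i} → Lab label i ⇔ (Lab z i ⊎ Rel z i b)
  lab-label = lab-fromDec (rel? z) labelledLab?

  label-valid : Valid z → Valid label
  label-valid vz = record
    { ~-refl  = from rel-label (~-refl vz)
    ; ~-sym   = from rel-label ∘ ~-sym vz ∘ to rel-label
    ; ~-trans = λ e e′ → from rel-label (~-trans vz (to rel-label e) (to rel-label e′))
    ; ~-lab   = λ e l → from lab-label
        ([ inj₁ ∘ ~-lab vz (to rel-label e) , inj₂ ∘ ~-trans vz (~-sym vz (to rel-label e)) ]′ (to lab-label l))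
    }

labelling : ∀ {n} → Fin n → Closure n
labelling b = record
  { cl        = label b
  ; Closed    = λ z → Lab z b
  ; cl-valid  = λ {z} → label-valid b z
  ; cl-closed = λ {z} vz → from (lab-label b z) (inj₂ (~-refl vz))
  ; cl-⊒      = λ {z} _ → ⊑-intro (from (rel-label b z)) (from (lab-label b z) ∘ inj₁)
  ; cl-least  = λ {z} _ vy z⊑y cy → ⊑-intro (⊑-rel z⊑y ∘ to (rel-label b z))
      ([ ⊑-lab z⊑y , (λ e → ~-lab vy (~-sym vy (⊑-rel z⊑y e)) cy) ]′ ∘ to (lab-label b z))
  }

-- Merging the blocks of two elements

module _ {n} (p q : Fin n) (z : Raw n) where

  -- The relation of `z` is already transitive, so a single crossing between the blocks of `p` and
  -- `q`, in either direction, yields the whole equivalence generated by adding the pair.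
  MergedRel : Fin n → Fin n → Set
  MergedRel i j = Rel z i j ⊎ (Rel z i p × Rel z q j) ⊎ (Rel z i q × Rel z p j)

  MergedLab : Fin n → Set
  MergedLab i = Lab z i ⊎ (Rel z i p × Lab z q) ⊎ (Rel z i q × Lab z p)

  mergedRel? : ∀ i j → Dec (MergedRel i j)
  mergedRel? i j = rel? z i j ⊎-dec (rel? z i p ×-dec rel? z q j) ⊎-dec (rel? z i q ×-dec rel? z p j)

  mergedLab? : ∀ i → Dec (MergedLab i)
  mergedLab? i = lab? z i ⊎-dec (rel? z i p ×-dec lab? z q) ⊎-dec (rel? z i q ×-dec lab? z p)

  merge : Raw n
  merge = fromDec mergedRel? mergedLab?

  rel-merge : ∀ {i j} → Rel merge i j ⇔ MergedRel i j
  rel-merge = rel-fromDec mergedRel? mergedLab?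

  lab-merge : ∀ {i} → Lab merge i ⇔ MergedLab i
  lab-merge = lab-fromDec mergedRel? mergedLab?

  merge-valid : Valid z → Valid merge
  merge-valid vz = record
    { ~-refl  = from rel-merge (inj₁ (~-refl vz))
    ; ~-sym   = λ e → from rel-merge (sym′ (to rel-merge e))
    ; ~-trans = λ e e′ → from rel-merge (trans′ (to rel-merge e) (to rel-merge e′))
    ; ~-lab   = λ e l → from lab-merge (lab′ (to rel-merge e) (to lab-merge l))
    }
    where
    infixr 5 _∙_
    _∙_ = ~-trans vz
    ~-sym′ = ~-sym vz
    sym′ : ∀ {i j} → MergedRel i j → MergedRel j i
    sym′ (inj₁ e)              = inj₁ (~-sym′ e)
    sym′ (inj₂ (inj₁ (e , f))) = inj₂ (inj₂ (~-sym′ f , ~-sym′ e))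
    sym′ (inj₂ (inj₂ (e , f))) = inj₂ (inj₁ (~-sym′ f , ~-sym′ e))
    trans′ : ∀ {i j k} → MergedRel i j → MergedRel j k → MergedRel i k
    trans′ (inj₁ e)              (inj₁ e′)               = inj₁ (e ∙ e′)
    trans′ (inj₁ e)              (inj₂ (inj₁ (e′ , f′))) = inj₂ (inj₁ (e ∙ e′ , f′))
    trans′ (inj₁ e)              (inj₂ (inj₂ (e′ , f′))) = inj₂ (inj₂ (e ∙ e′ , f′))
    trans′ (inj₂ (inj₁ (e , f))) (inj₁ e′)               = inj₂ (inj₁ (e , f ∙ e′))
    trans′ (inj₂ (inj₂ (e , f))) (inj₁ e′)               = inj₂ (inj₂ (e , f ∙ e′))
    trans′ (inj₂ (inj₁ (e , f))) (inj₂ (inj₁ (e′ , f′))) = inj₂ (inj₁ (e , f′))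
    -- Crossing to the block of `q` and back ends in the block of `p`, where `i` started.
    trans′ (inj₂ (inj₁ (e , f))) (inj₂ (inj₂ (e′ , f′))) = inj₁ (e ∙ f′)
    trans′ (inj₂ (inj₂ (e , f))) (inj₂ (inj₁ (e′ , f′))) = inj₁ (e ∙ f′)
    trans′ (inj₂ (inj₂ (e , f))) (inj₂ (inj₂ (e′ , f′))) = inj₂ (inj₂ (e , f′))
    lab′ : ∀ {i j} → MergedRel i j → MergedLab i → MergedLab j
    lab′ (inj₁ e)              (inj₁ l)              = inj₁ (~-lab vz e l)
    lab′ (inj₁ e)              (inj₂ (inj₁ (f , l))) = inj₂ (inj₁ (~-sym′ e ∙ f , l))
    lab′ (inj₁ e)              (inj₂ (inj₂ (f , l))) = inj₂ (inj₂ (~-sym′ e ∙ f , l))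
    lab′ (inj₂ (inj₁ (e , f))) (inj₁ l)              = inj₂ (inj₂ (~-sym′ f , ~-lab vz e l))
    lab′ (inj₂ (inj₁ (e , f))) (inj₂ (inj₁ (g , l))) = inj₁ (~-lab vz f l)
    lab′ (inj₂ (inj₁ (e , f))) (inj₂ (inj₂ (g , l))) = inj₂ (inj₂ (~-sym′ f , l))
    lab′ (inj₂ (inj₂ (e , f))) (inj₁ l)              = inj₂ (inj₁ (~-sym′ f , ~-lab vz e l))
    lab′ (inj₂ (inj₂ (e , f))) (inj₂ (inj₁ (g , l))) = inj₂ (inj₁ (~-sym′ f , l))
    lab′ (inj₂ (inj₂ (e , f))) (inj₂ (inj₂ (g , l))) = inj₁ (~-lab vz f l)

  merge-least : ∀ {y} → Valid y → z ⊑ y → Rel y p q → merge ⊑ y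
  merge-least {y} vy z⊑y pq = ⊑-intro (rel′ ∘ to rel-merge) (lab′ ∘ to lab-merge)
    where
    qp = ~-sym vy pq
    rel′ : ∀ {i j} → MergedRel i j → Rel y i j
    rel′ (inj₁ e)              = ⊑-rel z⊑y e
    rel′ (inj₂ (inj₁ (e , f))) = ~-trans vy (⊑-rel z⊑y e) (~-trans vy pq (⊑-rel z⊑y f))
    rel′ (inj₂ (inj₂ (e , f))) = ~-trans vy (⊑-rel z⊑y e) (~-trans vy qp (⊑-rel z⊑y f))
    lab′ : ∀ {i} → MergedLab i → Lab y i
    lab′ (inj₁ l)              = ⊑-lab z⊑y l
    lab′ (inj₂ (inj₁ (e , l))) = ~-lab vy (~-trans vy qp (~-sym vy (⊑-rel z⊑y e))) (⊑-lab z⊑y l)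
    lab′ (inj₂ (inj₂ (e , l))) = ~-lab vy (~-trans vy pq (~-sym vy (⊑-rel z⊑y e))) (⊑-lab z⊑y l)

merging : ∀ {n} → Fin n → Fin n → Closure n
merging p q = record
  { cl        = merge p q
  ; Closed    = λ z → Rel z p q
  ; cl-valid  = λ {z} → merge-valid p q z
  ; cl-closed = λ {z} vz → from (rel-merge p q z) (inj₂ (inj₁ (~-refl vz , ~-refl vz)))
  ; cl-⊒      = λ {z} _ → ⊑-intro (from (rel-merge p q z) ∘ inj₁) (from (lab-merge p q z) ∘ inj₁)
  ; cl-least  = λ {z} _ → merge-least p q z
  }

-- Splitting a block off along a finer partition

module _ {n} (p : Fin n) (π y : Raw n) where

  SameSide : Fin n → Fin n → Set
  SameSide i j = Rel π i p × Rel π j p ⊎ ¬ Rel π i p × ¬ Rel π j p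

  SplitRel : Fin n → Fin n → Set
  SplitRel i j = Rel y i j × SameSide i j

  splitRel? : ∀ i j → Dec (SplitRel i j)
  splitRel? i j = rel? y i j ×-dec
    ((rel? π i p ×-dec rel? π j p) ⊎-dec (Dec.¬? (rel? π i p) ×-dec Dec.¬? (rel? π j p)))

  -- For `π ⊑ y`, only the block of `p` in `y` is affected: it is cut into the block of `p` in `π`
  -- and the remainder. In `μ-sign` this supplies an element of the fibre over `y` other than `y`
  -- itself, without which the sign there would not be strict.
  split : Raw n
  split = fromDec splitRel? (lab? y)

  rel-split : ∀ {i j} → Rel split i j ⇔ SplitRel i j
  rel-split = rel-fromDec splitRel? (lab? y)

  lab-split : ∀ {i} → Lab split i ⇔ Lab y i
  lab-split = lab-fromDec splitRel? (lab? y)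

  split-valid : Valid y → Valid split
  split-valid vy = record
    { ~-refl  = λ {i} → from rel-split (~-refl vy , side i)
    ; ~-sym   = λ e → let (r , s) = to rel-split e in from rel-split (~-sym vy r , flip s)
    ; ~-trans = λ e e′ → let (r , s) = to rel-split e; (r′ , s′) = to rel-split e′ in
                  from rel-split (~-trans vy r r′ , join s s′)
    ; ~-lab   = λ e → from lab-split ∘ ~-lab vy (proj₁ (to rel-split e)) ∘ to lab-split
    }
    where
    side : ∀ i → SameSide i i
    side i with rel? π i p
    ... | yes e = inj₁ (e , e)
    ... | no ¬e = inj₂ (¬e , ¬e)
    flip : ∀ {i j} → SameSide i j → SameSide j i
    flip (inj₁ (e , f)) = inj₁ (f , e)
    flip (inj₂ (e , f)) = inj₂ (f , e)
    join : ∀ {i j k} → SameSide i j → SameSide j k → SameSide i k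
    join (inj₁ (e , _)) (inj₁ (_ , f)) = inj₁ (e , f)
    join (inj₁ (_ , e)) (inj₂ (¬e , _)) = contradiction e ¬e
    join (inj₂ (_ , ¬e)) (inj₁ (e , _)) = contradiction e ¬e
    join (inj₂ (e , _)) (inj₂ (_ , f)) = inj₂ (e , f)

  split-⊑ : split ⊑ y
  split-⊑ = ⊑-intro (proj₁ ∘ to rel-split) (to lab-split)

  ⊑-split : Valid π → π ⊑ y → π ⊑ split
  ⊑-split vπ π⊑y = ⊑-intro (λ {i} {j} e → from rel-split (⊑-rel π⊑y e , same e)) (from lab-split ∘ ⊑-lab π⊑y)
    where
    same : ∀ {i j} → Rel π i j → SameSide i j
    same {i} {j} e with rel? π i p
    ... | yes f = inj₁ (f , ~-trans vπ (~-sym vπ e) f)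
    ... | no ¬f = inj₂ (¬f , λ f → ¬f (~-trans vπ e f))

  split-separates : ∀ {q} → Valid π → ¬ Rel π p q → ¬ Rel split p q
  split-separates vπ ¬pq e with proj₂ (to rel-split e)
  ... | inj₁ (_ , qp)  = ¬pq (~-sym vπ qp)
  ... | inj₂ (¬pp , _) = ¬pp (~-refl vπ)

  -- The cut leaves `p` and `q` in different pieces of one block of `y`, and there are only two
  -- pieces, so joining `p` to `q` restores the block.
  merge-split : ∀ {q} → Valid π → Valid y → π ⊑ y → Rel y p q → ¬ Rel π p q → merge p q split ≡ y
  merge-split {q} vπ vy π⊑y pq ¬pq = ⊑-antisym
    (merge-least p q split vy split-⊑ pq)
    (⊑-intro (from (rel-merge p q split) ∘ rel′) (from (lab-merge p q split) ∘ inj₁ ∘ from lab-split))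
    where
    p-split : ∀ {i} → Rel π i p → Rel split i p
    p-split e = from rel-split (⊑-rel π⊑y e , inj₁ (e , ~-refl vπ))
    -- The remainder of the cut block is one block of the split, and `q` belongs to it because `π`
    -- does not relate `p` and `q`.
    q-split : ∀ {i j} → Rel y i j → Rel π i p → ¬ Rel π j p → Rel split q j
    q-split e i~p j≁p = from rel-split
      ( ~-trans vy (~-sym vy pq) (~-trans vy (~-sym vy (⊑-rel π⊑y i~p)) e)
      , inj₂ (¬pq ∘ ~-sym vπ , j≁p))
    rel′ : ∀ {i j} → Rel y i j → MergedRel p q split i j
    rel′ {i} {j} e with rel? π i p | rel? π j p
    ... | yes a | yes b = inj₁ (from rel-split (e , inj₁ (a , b)))
    ... | no a  | no b  = inj₁ (from rel-split (e , inj₂ (a , b)))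
    ... | yes a | no b  = inj₂ (inj₁ (p-split a , q-split e a b))
    ... | no a  | yes b = inj₂ (inj₂
      ( ~-sym (split-valid vy) (q-split (~-sym vy e) b a) , ~-sym (split-valid vy) (p-split b)))

-- Uniting the labelled blocks

rel-star : ∀ {n} (π : Raw n) {i j} → Rel (star π) i j ⇔ (Rel π i j ⊎ Lab π i × Lab π j)
rel-star π {i} {j}
  rewrite Vec.lookup∘tabulate (λ i → tabulate (λ j → rel π i j ∨ (lab π i ∧ lab π j))) i
        | Vec.lookup∘tabulate (λ j → rel π i j ∨ (lab π i ∧ lab π j)) j
  with rel π i j | lab π i | lab π j
... | true  | _     | _     = mk⇔ inj₁ (const refl)
... | false | true  | true  = mk⇔ (λ _ → inj₂ (refl , refl)) (const refl)
... | false | true  | false = mk⇔ (λ ()) λ { (inj₁ ()) ; (inj₂ (_ , ())) }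
... | false | false | _     = mk⇔ (λ ()) λ { (inj₁ ()) ; (inj₂ (() , _)) }

⊑-star : ∀ {n} {π : Raw n} → π ⊑ star π
⊑-star {π = π} = ⊑-intro (from (rel-star π) ∘ inj₁) (λ l → l)

star-valid : ∀ {n} {π : Raw n} → Valid π → Valid (star π)
star-valid {π = π} vπ = record
  { ~-refl  = from (rel-star π) (inj₁ (~-refl vπ))
  ; ~-sym   = from (rel-star π) ∘ [ inj₁ ∘ ~-sym vπ , (λ (l , l′) → inj₂ (l′ , l)) ]′ ∘ to (rel-star π)
  ; ~-trans = λ e e′ → from (rel-star π) (trans′ (to (rel-star π) e) (to (rel-star π) e′))
  ; ~-lab   = λ e l → [ (λ r → ~-lab vπ r l) , proj₂ ]′ (to (rel-star π) e)
  }
  where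
  trans′ : ∀ {i j k} → Rel π i j ⊎ Lab π i × Lab π j → Rel π j k ⊎ Lab π j × Lab π k →
           Rel π i k ⊎ Lab π i × Lab π k
  trans′ (inj₁ e)       (inj₁ e′)        = inj₁ (~-trans vπ e e′)
  trans′ (inj₁ e)       (inj₂ (lj , lk)) = inj₂ (~-lab vπ (~-sym vπ e) lj , lk)
  trans′ (inj₂ (li , lj)) (inj₁ e)       = inj₂ (li , ~-lab vπ e lj)
  trans′ (inj₂ (li , _)) (inj₂ (_ , lk)) = inj₂ (li , lk)

-- Counting blocks

IsMin : ∀ {n} → Raw n → Fin n → Set
IsMin z i = ∀ j → toℕ j < toℕ i → ¬ Rel z j i

isMin⇔ : ∀ {n} {z : Raw n} {i} → isMin z i ≡ true ⇔ IsMin z i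
isMin⇔ {n} {z} {i} = mk⇔
  (λ e j j<i → to not⇔ (to ⇒ᵇ⇔ (to all⇔ e j) (from <ᵇ⇔ j<i)))
  (λ h → from all⇔ λ j → from ⇒ᵇ⇔ λ j<i → from not⇔ (h j (to <ᵇ⇔ j<i)))
  where all⇔ = ∀Fin⇔ (λ j → (toℕ j <ᵇ toℕ i) ⇒ᵇ not (rel z j i))

module _ {n} {z : Raw n} (vz : Valid z) where

  minimum : ∀ i → ∃ λ j → IsMin z j × Rel z j i
  minimum i = go i (<-wellFounded (toℕ i))
    where
    go : ∀ i → Acc _<_ (toℕ i) → ∃ λ j → IsMin z j × Rel z j i
    go i (acc rs) with Fin.any? (λ j → toℕ j ℕ.<? toℕ i ×-dec rel? z j i)
    ... | no ∄          = i , (λ j j<i e → ∄ (j , j<i , e)) , ~-refl vz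
    ... | yes (j , j<i , e) with go j (rs j<i)
    ...   | k , min , f = k , min , ~-trans vz f e

  minimum-unique : ∀ {i j} → IsMin z i → IsMin z j → Rel z i j → i ≡ j
  minimum-unique {i} {j} mi mj e with ℕ.<-cmp (toℕ i) (toℕ j)
  ... | tri< i<j _ _ = contradiction e (mj i i<j)
  ... | tri≈ _ i≡j _ = Fin.toℕ-injective i≡j
  ... | tri> _ _ j<i = contradiction (~-sym vz e) (mi j j<i)

  module _ (p : Fin n → Bool) (p-resp : ∀ {i j} → Rel z i j → p i ≡ true → p j ≡ true) where

    private
      minᵇ : Fin n → Bool
      minᵇ i = isMin z i ∧ p i

      blocks-of : List (Fin n)
      blocks-of = filter (λ i → minᵇ i Bool.≟ true) (allFin n)

      ∈⇒ : ∀ {i} → i ∈ blocks-of → IsMin z i × p i ≡ true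
      ∈⇒ {i} i∈ = let e = proj₂ (∈-filter⁻ (λ i → minᵇ i Bool.≟ true) {xs = allFin n} i∈) in
        to (isMin⇔ {z = z}) (∧-conicalˡ _ _ e) , ∧-conicalʳ (isMin z i) _ e

      ∈⇐ : ∀ {i} → IsMin z i → p i ≡ true → i ∈ blocks-of
      ∈⇐ mi e = ∈-filter⁺ (λ i → minᵇ i Bool.≟ true) (∈-allFin _) (∧-intro (from (isMin⇔ {z = z}) mi) e)

    -- As `p` is constant on blocks, the blocks on which it holds correspond to their minima, by
    -- `minimum` and `minimum-unique`. With `p` the label or its negation, the block counts of the
    -- theorem become statements about the relation.
    count≤1⇔ : count n minᵇ ≤ 1 ⇔ (∀ i j → p i ≡ true → p j ≡ true → Rel z i j)
    count≤1⇔ = mk⇔ to′ λ h → ≡⇒length≤1 (Unique.filter⁺ (λ i → minᵇ i Bool.≟ true) (Unique.allFin⁺ n))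
      λ {i} {j} i∈ j∈ → let (mi , pi) = ∈⇒ i∈; (mj , pj) = ∈⇒ j∈ in minimum-unique mi mj (h i j pi pj)
      where
      to′ : count n minᵇ ≤ 1 → ∀ i j → p i ≡ true → p j ≡ true → Rel z i j
      to′ h i j pi pj with minimum i | minimum j
      ... | k , mk , ki | l , ml , lj = ~-trans vz (~-sym vz ki) (subst (λ m → Rel z m j) (sym k≡l) lj)
        where k≡l = length≤1⇒≡ h (∈⇐ mk (p-resp (~-sym vz ki) pi)) (∈⇐ ml (p-resp (~-sym vz lj) pj))

    count>0⇔ : 0 < count n minᵇ ⇔ ∃ λ i → p i ≡ true
    count>0⇔ = mk⇔
      (λ h → let (i , i∈) = length>0⇒∈ blocks-of h in i , proj₂ (∈⇒ i∈))
      (λ (i , pi) → let (j , mj , ji) = minimum i in ∈⇒length>0 (∈⇐ mj (p-resp (~-sym vz ji) pi)))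

blocks : ∀ {n} → Raw n → ℕ
blocks {n} z = countᵇ (isMin z) (allFin n)

-- Lets `blocks-merge` assume that the block of `p` has the smaller minimum.
merge-swap : ∀ {n} (p q : Fin n) (z : Raw n) → merge p q z ≡ merge q p z
merge-swap p q z = ⊑-antisym (half p q) (half q p)
  where
  swap : ∀ {A B C : Set} → A ⊎ B ⊎ C → A ⊎ C ⊎ B
  swap (inj₁ a)        = inj₁ a
  swap (inj₂ (inj₁ b)) = inj₂ (inj₂ b)
  swap (inj₂ (inj₂ c)) = inj₂ (inj₁ c)
  half : ∀ p q → merge p q z ⊑ merge q p z
  half p q = ⊑-intro (from (rel-merge q p z) ∘ swap ∘ to (rel-merge p q z))
                     (from (lab-merge q p z) ∘ swap ∘ to (lab-merge p q z))

-- The only block minimum lost by merging is the larger of the minima of the two merged blocks.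
blocks-merge-< : ∀ {n} {p q p₀ q₀ : Fin n} {w} → Valid w → IsMin w p₀ → Rel w p₀ p →
                 IsMin w q₀ → Rel w q₀ q → toℕ p₀ < toℕ q₀ → blocks w ≡ suc (blocks (merge p q w))
blocks-merge-< {n} {p} {q} {p₀} {q₀} {w} vw mp p₀p mq q₀q p₀<q₀ =
  countᵇ-remove {p = isMin w} {isMin (merge p q w)} (Unique.allFin⁺ n) (∈-allFin q₀)
    (from (isMin⇔ {z = w}) mq)
    (¬-not λ e → to (isMin⇔ {z = merge p q w}) e p₀ p₀<q₀
      (from (rel-merge p q w) (inj₂ (inj₁ (p₀p , ~-sym vw q₀q)))))
    λ {i} i≢q₀ → bool-ext
      (λ e → from (isMin⇔ {z = merge p q w}) λ j j<i f →
        stays i≢q₀ (to (isMin⇔ {z = w}) e) j j<i (to (rel-merge p q w) f))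
      (λ e → from (isMin⇔ {z = w}) λ j j<i f →
        to (isMin⇔ {z = merge p q w}) e j j<i (from (rel-merge p q w) (inj₁ f)))
  where
  stays : ∀ {i} → i ≢ q₀ → IsMin w i → ∀ j → toℕ j < toℕ i → ¬ MergedRel p q w j i
  stays i≢q₀ mi j j<i (inj₁ e)              = mi j j<i e
  stays i≢q₀ mi j j<i (inj₂ (inj₁ (_ , e))) =
    i≢q₀ (minimum-unique vw mi mq (~-sym vw (~-trans vw q₀q e)))
  stays i≢q₀ mi j j<i (inj₂ (inj₂ (e , f))) with refl ← minimum-unique vw mp mi (~-trans vw p₀p f) =
    mq j (ℕ.<-trans j<i p₀<q₀) (~-trans vw e (~-sym vw q₀q))

blocks-merge : ∀ {n} {p q : Fin n} {w} → Valid w → ¬ Rel w p q → blocks w ≡ suc (blocks (merge p q w))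
blocks-merge {p = p} {q} {w} vw ¬pq with minimum vw p | minimum vw q
... | p₀ , mp , p₀p | q₀ , mq , q₀q with ℕ.<-cmp (toℕ p₀) (toℕ q₀)
... | tri< p₀<q₀ _ _ = blocks-merge-< vw mp p₀p mq q₀q p₀<q₀
... | tri≈ _ p₀≡q₀ _ with refl ← Fin.toℕ-injective p₀≡q₀ = contradiction (~-trans vw (~-sym vw p₀p) q₀q) ¬pq
... | tri> _ _ q₀<p₀ =
  trans (blocks-merge-< vw mq q₀q mp p₀p q₀<p₀) (cong (suc ∘ blocks) (merge-swap q p w))

-- Signs, and the labelled and unlabelled block counts

sgn : ℕ → ℤ
sgn zero    = 1ℤ
sgn (suc k) = - sgn k

-- A sign squares to one. The trailing factor `a` matches the nested product in `μ-sign` when its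
-- two arguments coincide.
sgn-involutive : ∀ k a → sgn k * (sgn k * a) ≡ a
sgn-involutive zero    a = trans (ℤ.*-identityˡ _) (ℤ.*-identityˡ a)
sgn-involutive (suc k) a = begin
  - sgn k * (- sgn k * a)   ≡⟨ cong (- sgn k *_) (ℤ.neg-distribˡ-* (sgn k) a) ⟨
  - sgn k * - (sgn k * a)   ≡⟨ ℤ.neg-distribˡ-* (sgn k) _ ⟨
  - (sgn k * - (sgn k * a)) ≡⟨ cong -_ (ℤ.neg-distribʳ-* (sgn k) _) ⟨
  - - (sgn k * (sgn k * a)) ≡⟨ ℤ.neg-involutive _ ⟩
  sgn k * (sgn k * a)       ≡⟨ sgn-involutive k a ⟩
  a                         ∎
  where open ≡-Reasoning

m-one : ∀ {n} (σ : Raw n) → labBlocks σ ≡ 1 → m σ ≡ 1ℤ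
m-one σ h with labBlocks σ
m-one σ refl | .1 = refl

m-other : ∀ {n} (σ : Raw n) → labBlocks σ ≢ 1 → m σ ≡ 0ℤ
m-other σ h with labBlocks σ
... | zero        = refl
... | suc zero    = contradiction refl h
... | suc (suc _) = refl

labBlocks≤1⇔ : ∀ {n} {z : Raw n} → Valid z → labBlocks z ≤ 1 ⇔ (∀ i j → Lab z i → Lab z j → Rel z i j)
labBlocks≤1⇔ {z = z} vz = count≤1⇔ vz (lab z) (~-lab vz)

labBlocks>0⇔ : ∀ {n} {z : Raw n} → Valid z → 0 < labBlocks z ⇔ ∃ (Lab z)
labBlocks>0⇔ {z = z} vz = count>0⇔ vz (lab z) (~-lab vz)

unlabBlocks≤1⇔ : ∀ {n} {z : Raw n} → Valid z →
                 unlabBlocks z ≤ 1 ⇔ (∀ i j → ¬ Lab z i → ¬ Lab z j → Rel z i j)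
unlabBlocks≤1⇔ {z = z} vz = mk⇔
  (λ h i j ¬li ¬lj → to ⇔′ h i j (from not⇔ ¬li) (from not⇔ ¬lj))
  (λ h → from ⇔′ λ i j ei ej → h i j (to not⇔ ei) (to not⇔ ej))
  where
  ⇔′ = count≤1⇔ vz (not ∘ lab z) (λ e u → from not⇔ (to not⇔ u ∘ ~-lab vz (~-sym vz e)))

-- The Möbius function on fibres of a closure operator, and its sign

module Mobius {n : ℕ} {μ : Raw n → Raw n → ℤ} (isμ : IsMobius μ) where

  open IsMobius isμ

  Sum-interval : ∀ {x y} → Valid x → Valid y → x ⊑ y → x ≢ y →
                 Sum (λ z → when (x ⊑? z ×-dec z ⊑? y) (μ x z)) ≡ 0ℤ
  Sum-interval {x} {y} vx vy x⊑y x≢y =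
    trans (Sum-cong λ {z} _ → cong (λ b → if b then μ x z else 0ℤ)
             (bool-ext (λ e → ∧-intro (from leq⇔ (proj₁ (to (does⇔ (x ⊑? z ×-dec z ⊑? y)) e)))
                                      (from leq⇔ (proj₂ (to (does⇔ (x ⊑? z ×-dec z ⊑? y)) e))))
                       (λ e → from (does⇔ (x ⊑? z ×-dec z ⊑? y))
                                (to leq⇔ (∧-conicalˡ _ _ e) , to leq⇔ (∧-conicalʳ (leq x z) _ e)))))
          (μ-sum x y (from valid⇔ vx) (from valid⇔ vy) (from leq⇔ x⊑y) x≢y)

  module _ (C : Closure n) where
    open Closure C

    fibre : Raw n → Raw n → ℤ
    fibre x y = Sum (λ z → when (x ⊑? z ×-dec cl z ≟ᴿ y) (μ x z))

    -- Each `z ⊒ x` lies in exactly one fibre, the one over `cl z`. So its term equals a sum over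
    -- all `w` with one nonzero candidate, and the two summations can be exchanged.
    Sum-fibre : ∀ {x} {Q : Raw n → Set} (Q? : ∀ w → Dec (Q w)) →
                Sum (λ z → when (x ⊑? z ×-dec Q? (cl z)) (μ x z)) ≡ Sum (λ w → when (Q? w) (fibre x w))
    Sum-fibre {x} Q? = begin
      Sum (λ z → when (x ⊑? z ×-dec Q? (cl z)) (μ x z))
        ≡⟨ Sum-cong (λ {z} vz → trans (diagonal z)
             (sym (Sum-single (cl-valid vz) λ {w} _ w≢ → trans
               (cong (when (Q? w)) (when-no (x ⊑? z ×-dec cl z ≟ᴿ w) (λ p → w≢ (sym (proj₂ p)))))
               (when-zero (Q? w))))) ⟩
      Sum (λ z → Sum (λ w → when (Q? w) (when (x ⊑? z ×-dec cl z ≟ᴿ w) (μ x z))))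
        ≡⟨ sum-swap (λ z w → when (Q? w) (when (x ⊑? z ×-dec cl z ≟ᴿ w) (μ x z))) (ΠL n) (ΠL n) ⟩
      Sum (λ w → Sum (λ z → when (Q? w) (when (x ⊑? z ×-dec cl z ≟ᴿ w) (μ x z))))
        ≡⟨ Sum-cong (λ {w} _ → sym (when-sum (Q? w) _ (ΠL n))) ⟩
      Sum (λ w → when (Q? w) (fibre x w)) ∎
      where
      open ≡-Reasoning
      diagonal : ∀ z → when (x ⊑? z ×-dec Q? (cl z)) (μ x z) ≡
                       when (Q? (cl z)) (when (x ⊑? z ×-dec cl z ≟ᴿ cl z) (μ x z))
      diagonal z rewrite dec-true (cl z ≟ᴿ cl z) refl with does (x ⊑? z) | does (Q? (cl z))
      ... | false | false = refl
      ... | false | true  = refl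
      ... | true  | false = refl
      ... | true  | true  = refl

    -- Rota's closure theorem; the induction is on closed y, since the fibres over the closed w ⊑ y
    -- partition the interval from x to y.
    fibre-zero : ∀ {x y} → Valid x → ¬ Closed x → Valid y → fibre x y ≡ 0ℤ
    fibre-zero {x} {y} vx ¬cx = go y (<-wellFounded _)
      where
      empty : ∀ {y} → (∀ {z} → Valid z → x ⊑ z → cl z ≢ y) → fibre x y ≡ 0ℤ
      empty {y} h = sum-zero (ΠL n) λ {z} z∈ →
        when-no (x ⊑? z ×-dec cl z ≟ᴿ y) λ p → h (to ∈ΠL⇔ z∈) (proj₁ p) (proj₂ p)

      go : ∀ y → Acc _<_ (size y) → Valid y → fibre x y ≡ 0ℤ
      go y (acc rs) vy with x ⊑? y
      ... | no x⋢y = empty λ {z} vz x⊑z clz≡y → x⋢y (subst (x ⊑_) clz≡y (⊑-trans x⊑z (cl-⊒ vz)))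
      ... | yes x⊑y with cl y ≟ᴿ y
      -- Any element of the fibre would exhibit `y` as a closure, hence as closed and fixed by `cl`.
      ...   | no cly≢y = empty λ {z} vz _ clz≡y → cly≢y (cl-id vy (subst Closed clz≡y (cl-closed vz)))
      ...   | yes cly≡y = begin
        fibre x y
          ≡⟨ when-yes (y ⊑? y) ⊑-refl ⟨
        when (y ⊑? y) (fibre x y)
          ≡⟨ Sum-single vy (λ {w} vw w≢y → below w vw w≢y) ⟨
        Sum (λ w → when (w ⊑? y) (fibre x w))
          ≡⟨ Sum-fibre (_⊑? y) ⟨
        Sum (λ z → when (x ⊑? z ×-dec cl z ⊑? y) (μ x z))
          ≡⟨ Sum-cong (λ {z} vz → when-⇔ (x ⊑? z ×-dec cl z ⊑? y) (x ⊑? z ×-dec z ⊑? y)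
               (mk⇔ (λ p → proj₁ p , ⊑-trans (cl-⊒ vz) (proj₂ p))
                    (λ p → proj₁ p , cl-least vz vy (proj₂ p) cy)) (λ _ → refl)) ⟩
        Sum (λ z → when (x ⊑? z ×-dec z ⊑? y) (μ x z))
          ≡⟨ Sum-interval vx vy x⊑y (λ x≡y → ¬cx (subst Closed (sym x≡y) cy)) ⟩
        0ℤ ∎
        where
        open ≡-Reasoning
        cy = subst Closed cly≡y (cl-closed vy)
        below : ∀ w → Valid w → w ≢ y → when (w ⊑? y) (fibre x w) ≡ 0ℤ
        below w vw w≢y with w ⊑? y
        ... | no _    = refl
        ... | yes w⊑y = go w (rs (size-strict vy w⊑y w≢y)) vw

    -- A condition on `cl z` alone selects whole fibres, each of which sums to zero.
    Sum-fibres-zero : ∀ {x} {Q : Raw n → Set} (Q? : ∀ w → Dec (Q w)) → Valid x → ¬ Closed x →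
                      Sum (λ z → when (x ⊑? z ×-dec Q? (cl z)) (μ x z)) ≡ 0ℤ
    Sum-fibres-zero Q? vx ¬cx = trans (Sum-fibre Q?) (sum-zero (ΠL n) λ {w} w∈ →
      trans (cong (when (Q? w)) (fibre-zero vx ¬cx (to ∈ΠL⇔ w∈))) (when-zero (Q? w)))

  -- Labelling the block of `b` changes no relation, so any `z ⊒ x` whose closure is `y` already
  -- relates `a` to `b`. Since `a` is labelled in `x`, such a `z` is closed and therefore equal to
  -- `y`. The fibre sum is thus `μ x y` alone, and it vanishes because `x` is not closed.
  mixed-zero : ∀ {x y a b} → Valid x → Valid y → x ⊑ y → Lab x a → ¬ Lab x b → Rel y a b → μ x y ≡ 0ℤ
  mixed-zero {x} {y} {a} {b} vx vy x⊑y la ¬lb ab = begin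
    μ x y
      ≡⟨ when-yes (x ⊑? y ×-dec label b y ≟ᴿ y) (x⊑y , cl-id vy (~-lab vy ab (⊑-lab x⊑y la))) ⟨
    when (x ⊑? y ×-dec label b y ≟ᴿ y) (μ x y)
      ≡⟨ Sum-single vy (λ {z} vz z≢y → when-no (x ⊑? z ×-dec label b z ≟ᴿ y)
           λ (x⊑z , e) → z≢y (trans (sym (cl-id vz (closed vz x⊑z e))) e)) ⟨
    fibre (labelling b) x y
      ≡⟨ fibre-zero (labelling b) vx ¬lb vy ⟩
    0ℤ ∎
    where
    open ≡-Reasoning
    open Closure (labelling b) using (cl-id)
    closed : ∀ {z} → Valid z → x ⊑ z → label b z ≡ y → Lab z b
    closed {z} vz x⊑z e = ~-lab vz (to (rel-label b z) (subst (λ w → Rel w a b) (sym e) ab)) (⊑-lab x⊑z la)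

  -- Induction on `y`: the condition on labels is inherited by every `z` between `x` and `y`. The
  -- signs are nested as separate factors so that passing from `z` to `y` alters only the outer one.
  μ-sign : ∀ {x y} → Valid x → Valid y → x ⊑ y → (∀ i → Lab y i → Lab x i) →
           0ℤ ℤ.< sgn (blocks y) * (sgn (blocks x) * μ x y)
  μ-sign {x} {y} vx = go y (<-wellFounded _)
    where
    go : ∀ y → Acc _<_ (size y) → Valid y → x ⊑ y → (∀ i → Lab y i → Lab x i) →
         0ℤ ℤ.< sgn (blocks y) * (sgn (blocks x) * μ x y)
    go y (acc rs) vy x⊑y ly with Fin.any? (λ p → Fin.any? (λ q → rel? y p q ×-dec Dec.¬? (rel? x p q)))
    -- Nothing related in `y` is separated in `x`, and the labels agree, so `y` is `x` and the
    -- signed value is `μ x x`, which is one.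
    ... | no ∄ with refl ← ⊑-antisym x⊑y (⊑-intro (λ {i} {j} e → decidable-stable (rel? x i j)
                             λ ¬e → ∄ (i , j , e , ¬e)) (ly _)) =
      subst (0ℤ ℤ.<_) (sym (trans (sgn-involutive (blocks x) (μ x x)) (μ-refl x (from valid⇔ vx))))
        (ℤ.+<+ (s≤s z≤n))
    -- If the signed value at `y` were not positive, every signed term of the fibre sum would be at
    -- most zero and the one at `split p x y` negative, although the sum is zero.
    ... | yes (p , q , pq , ¬pq) = decidable-stable (0ℤ ℤ.<? a * (b * μ x y)) λ ≮ →
        ℤ.<-irrefl Sum-f (sum-neg (λ {z} z∈ → f≤0 (ℤ.≮⇒≥ ≮) (to ∈ΠL⇔ z∈)) (from ∈ΠL⇔ vs)
          (f<0 vs s≢y (⊑-split p x y vx x⊑y) (merge-split p x y vx vy x⊑y pq ¬pq)))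
      where
      a = sgn (blocks y)
      b = sgn (blocks x)
      s = split p x y
      vs = split-valid p x y vy
      s≢y : s ≢ y
      s≢y e = split-separates p x y vx ¬pq (subst (λ w → Rel w p q) (sym e) pq)
      InFibre? : ∀ z → Dec (x ⊑ z × merge p q z ≡ y)
      InFibre? z = x ⊑? z ×-dec merge p q z ≟ᴿ y
      f : Raw n → ℤ
      f z = a * (b * when (InFibre? z) (μ x z))
      ab0≡0 : a * (b * 0ℤ) ≡ 0ℤ
      ab0≡0 = trans (cong (a *_) (ℤ.*-zeroʳ b)) (ℤ.*-zeroʳ a)
      Sum-f : Sum f ≡ 0ℤ
      Sum-f = begin
        Sum f
          ≡⟨ sum-* a (λ z → b * when (InFibre? z) (μ x z)) (ΠL n) ⟩
        a * Sum (λ z → b * when (InFibre? z) (μ x z))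
          ≡⟨ cong (a *_) (sum-* b (λ z → when (InFibre? z) (μ x z)) (ΠL n)) ⟩
        a * (b * fibre (merging p q) x y)
          ≡⟨ cong (λ t → a * (b * t)) (fibre-zero (merging p q) vx ¬pq vy) ⟩
        a * (b * 0ℤ)
          ≡⟨ ab0≡0 ⟩
        0ℤ ∎
        where open ≡-Reasoning
      f<0 : ∀ {z} → Valid z → z ≢ y → x ⊑ z → merge p q z ≡ y → f z ℤ.< 0ℤ
      f<0 {z} vz z≢y x⊑z e rewrite dec-true (InFibre? z) (x⊑z , e) =
        ℤ.neg-cancel-< (subst (0ℤ ℤ.<_) flipped (go z (rs (size-strict vy z⊑y z≢y)) vz x⊑z
          λ i → ly i ∘ ⊑-lab z⊑y))
        where
        open Closure (merging p q) using (cl-⊒; cl-id)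
        z⊑y = subst (z ⊑_) e (cl-⊒ vz)
        -- Had `z` related `p` and `q`, merging would fix it and `z` would be `y`. So the merge
        -- joins two distinct blocks.
        blocks-z : blocks z ≡ suc (blocks y)
        blocks-z = trans (blocks-merge vz λ pq → z≢y (trans (sym (cl-id vz pq)) e)) (cong (suc ∘ blocks) e)
        flipped : sgn (blocks z) * (b * μ x z) ≡ - (a * (b * μ x z))
        flipped = trans (cong (λ k → sgn k * (b * μ x z)) blocks-z) (sym (ℤ.neg-distribˡ-* a _))
      f≤0 : a * (b * μ x y) ℤ.≤ 0ℤ → ∀ {z} → Valid z → f z ℤ.≤ 0ℤ
      f≤0 y≤0 {z} vz = case InFibre? z of λ where
        (no ∉)          → ℤ.≤-reflexive (trans (cong (λ t → a * (b * t)) (when-no (InFibre? z) ∉)) ab0≡0)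
        (yes (x⊑z , e)) → case z ≟ᴿ y of λ where
          (yes z≡y) → subst (ℤ._≤ 0ℤ)
            (trans (cong (λ w → a * (b * μ x w)) (sym z≡y))
                   (cong (λ t → a * (b * t)) (sym (when-yes (InFibre? z) (x⊑z , e))))) y≤0
          (no z≢y)  → ℤ.<⇒≤ (f<0 vz z≢y x⊑z e)

  -- Evaluation of λ

  module _ {π : Raw n} (vπ : Valid π) where

    -- When `π` has a labelled block, these are the `σ ⊒ π` whose only labelled block is the union
    -- of the labelled blocks of `π`.
    OneLabelled : Raw n → Set
    OneLabelled σ = star π ⊑ σ × (∀ i → Lab σ i → Lab π i)

    abstract
      oneLabelled? : ∀ σ → Dec (OneLabelled σ)
      oneLabelled? σ = star π ⊑? σ ×-dec Fin.all? (λ i → lab? σ i →-dec lab? π i)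

    -- For `σ` as in `OneLabelled`, `m σ` is one. Any other `σ` in the sum either has `m σ` zero or
    -- labels an element that `π` leaves unlabelled; its single labelled block then joins that
    -- element to the labelled `ι`, and `mixed-zero` applies.
    lam-sum : ∀ πX → inΠᵇ πX π ≡ true →
              lam μ πX π ≡ Sum (λ σ → when (oneLabelled? σ) (μ π σ))
    lam-sum πX π∈ = Sum-cong λ {σ} vσ → term vσ
      where
      e₁ = ∧-conicalʳ (valid π) _ π∈
      πX⊑π : πX ⊑ π
      πX⊑π = to leq⇔ (∧-conicalˡ _ _ e₁)
      labelled : ∃ (Lab π)
      labelled = to (labBlocks>0⇔ vπ) (to <ᵇ⇔ (∧-conicalʳ (leq πX π) _ e₁))
      ι = proj₁ labelled
      term : ∀ {σ} → Valid σ → (if inΠᵇ πX σ ∧ leq π σ then μ π σ * m σ else 0ℤ) ≡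
                               when (oneLabelled? σ) (μ π σ)
      term {σ} vσ with oneLabelled? σ
      ... | yes (π*⊑σ , lσ) = begin
        (if inΠᵇ πX σ ∧ leq π σ then μ π σ * m σ else 0ℤ)
          ≡⟨ cong (λ b → if b then μ π σ * m σ else 0ℤ) σ∈ ⟩
        μ π σ * m σ ≡⟨ cong (μ π σ *_) (m-one σ (ℕ.≤-antisym ≤1 >0)) ⟩
        μ π σ * 1ℤ  ≡⟨ ℤ.*-identityʳ _ ⟩
        μ π σ       ∎
        where
        open ≡-Reasoning
        π⊑σ = ⊑-trans ⊑-star π*⊑σ
        >0 : 0 < labBlocks σ
        >0 = from (labBlocks>0⇔ vσ) (ι , ⊑-lab π⊑σ (proj₂ labelled))
        ≤1 : labBlocks σ ≤ 1
        ≤1 = from (labBlocks≤1⇔ vσ) λ i j li lj → ⊑-rel π*⊑σ (from (rel-star π) (inj₂ (lσ i li , lσ j lj)))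
        σ∈ : inΠᵇ πX σ ∧ leq π σ ≡ true
        σ∈ = ∧-intro (∧-intro (from valid⇔ vσ) (∧-intro (from leq⇔ (⊑-trans πX⊑π π⊑σ)) (from <ᵇ⇔ >0)))
                     (from leq⇔ π⊑σ)
      ... | no ¬one with inΠᵇ πX σ ∧ leq π σ in σ∈
      ...   | false = refl
      ...   | true with labBlocks σ ℕ.≟ 1
      ...     | no ≢1  = trans (cong (μ π σ *_) (m-other σ ≢1)) (ℤ.*-zeroʳ (μ π σ))
      ...     | yes ≡1 = cong (_* m σ) μ≡0
        where
        π⊑σ : π ⊑ σ
        π⊑σ = to leq⇔ (∧-conicalʳ (inΠᵇ πX σ) _ σ∈)
        related : ∀ i j → Lab σ i → Lab σ j → Rel σ i j
        related = to (labBlocks≤1⇔ vσ) (ℕ.≤-reflexive ≡1)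
        π*⊑σ : star π ⊑ σ
        π*⊑σ = ⊑-intro ([ ⊑-rel π⊑σ , (λ (li , lj) → related _ _ (⊑-lab π⊑σ li) (⊑-lab π⊑σ lj)) ]′ ∘ to (rel-star π))
                       (⊑-lab π⊑σ)
        μ≡0 : μ π σ ≡ 0ℤ
        μ≡0 with Fin.any? (λ i → lab? σ i ×-dec Dec.¬? (lab? π i))
        ... | yes (i , li , ¬li) = mixed-zero vπ vσ π⊑σ (proj₂ labelled) ¬li
                                     (related ι i (⊑-lab π⊑σ (proj₂ labelled)) li)
        ... | no ∄ = contradiction (π*⊑σ , λ i li → decidable-stable (lab? π i) λ ¬li → ∄ (i , li , ¬li)) ¬one

    -- Since `p` and `q` are unlabelled in `π`, merging their blocks does not affect whether `σ` is
    -- `OneLabelled`. The guard can therefore be put on `merge p q σ`, where it selects whole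
    -- fibres, and `π` is not closed under this merging.
    Sum-oneLabelled-zero : ∀ {p q} → ¬ Lab π p → ¬ Lab π q → ¬ Rel π p q →
                           Sum (λ σ → when (oneLabelled? σ) (μ π σ)) ≡ 0ℤ
    Sum-oneLabelled-zero {p} {q} ¬lp ¬lq ¬pq = trans
      (Sum-cong λ {σ} vσ → when-⇔ (oneLabelled? σ) (π ⊑? σ ×-dec oneLabelled? (merge p q σ))
        (mk⇔ (to′ vσ) (from′ vσ)) (λ _ → refl))
      (Sum-fibres-zero (merging p q) oneLabelled? vπ ¬pq)
      where
      open Closure (merging p q) using (cl-⊒)
      to′ : ∀ {σ} → Valid σ → OneLabelled σ → π ⊑ σ × OneLabelled (merge p q σ)
      to′ {σ} vσ (π*⊑σ , lσ) = ⊑-trans ⊑-star π*⊑σ , ⊑-trans π*⊑σ (cl-⊒ vσ) , λ i l →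
        case to (lab-merge p q σ) l of λ where
          (inj₁ l)              → lσ i l
          (inj₂ (inj₁ (_ , l))) → contradiction (lσ q l) ¬lq
          (inj₂ (inj₂ (_ , l))) → contradiction (lσ p l) ¬lp
      from′ : ∀ {σ} → Valid σ → π ⊑ σ × OneLabelled (merge p q σ) → OneLabelled σ
      from′ {σ} vσ (π⊑σ , π*⊑ , lm) = ⊑-intro rel′ (⊑-lab π⊑σ) , lσ
        where
        lσ : ∀ i → Lab σ i → Lab π i
        lσ i = lm i ∘ ⊑-lab (cl-⊒ vσ)
        rel′ : ∀ {i j} → Rel (star π) i j → Rel σ i j
        rel′ e with to (rel-star π) e
        ... | inj₁ r        = ⊑-rel π⊑σ r
        ... | inj₂ (li , _) with to (rel-merge p q σ) (⊑-rel π*⊑ e)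
        ...   | inj₁ r              = r
        -- A relation created by the merge would place the labelled `i` in the block of `p` or `q`
        -- in `σ`, so that `p` or `q` would be labelled in `σ` and hence in `π`.
        ...   | inj₂ (inj₁ (r , _)) = contradiction (lσ p (~-lab vσ r (⊑-lab π⊑σ li))) ¬lp
        ...   | inj₂ (inj₂ (r , _)) = contradiction (lσ q (~-lab vσ r (⊑-lab π⊑σ li))) ¬lq

    -- A `OneLabelled` `σ` has the labels of `π`, so elements related in `σ` are both labelled or
    -- both unlabelled. In the first case `star π` relates them; in the second they share the only
    -- unlabelled block of `π`. Hence `σ ⊑ star π`, and equality follows.
    Sum-oneLabelled-star : (∀ i j → ¬ Lab π i → ¬ Lab π j → Rel π i j) →
                           Sum (λ σ → when (oneLabelled? σ) (μ π σ)) ≡ μ π (star π)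
    Sum-oneLabelled-star one = trans
      (Sum-single (star-valid vπ) λ {σ} vσ σ≢ → when-no (oneLabelled? σ) λ (π*⊑σ , lσ) →
        σ≢ (⊑-antisym (⊑-intro (λ {i} {j} e → from (rel-star π) (related vσ π*⊑σ lσ e)) (lσ _)) π*⊑σ))
      (when-yes (oneLabelled? (star π)) (⊑-refl , λ _ l → l))
      where
      related : ∀ {σ} → Valid σ → star π ⊑ σ → (∀ i → Lab σ i → Lab π i) →
                ∀ {i j} → Rel σ i j → Rel π i j ⊎ Lab π i × Lab π j
      related vσ π*⊑σ lσ {i} {j} e with lab? π i
      ... | yes li = inj₂ (li , lσ j (~-lab vσ e (⊑-lab π*⊑σ li)))
      ... | no ¬li = inj₁ (one i j ¬li λ lj → ¬li (lσ i (~-lab vσ (~-sym vσ e) (⊑-lab π*⊑σ lj))))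

    μ-star-nonzero : μ π (star π) ≢ 0ℤ
    μ-star-nonzero μ≡0 = ℤ.<-irrefl (sym product≡0) (μ-sign vπ (star-valid vπ) ⊑-star (λ _ l → l))
      where
      product≡0 : sgn (blocks (star π)) * (sgn (blocks π) * μ π (star π)) ≡ 0ℤ
      product≡0 = trans (cong (sgn (blocks (star π)) *_)
        (trans (cong (sgn (blocks π) *_) μ≡0) (ℤ.*-zeroʳ (sgn (blocks π))))) (ℤ.*-zeroʳ (sgn (blocks (star π))))

    lam-zero : ∀ πX → inΠᵇ πX π ≡ true → ¬ unlabBlocks π ≤ 1 → lam μ πX π ≡ 0ℤ
    lam-zero πX π∈ u≰1 with Fin.any? (λ p → Fin.any? (λ q →
                              Dec.¬? (lab? π p) ×-dec Dec.¬? (lab? π q) ×-dec Dec.¬? (rel? π p q)))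
    ... | yes (p , q , ¬lp , ¬lq , ¬pq) = trans (lam-sum πX π∈) (Sum-oneLabelled-zero ¬lp ¬lq ¬pq)
    ... | no ∄ = contradiction (from (unlabBlocks≤1⇔ vπ) λ i j ¬li ¬lj →
                   decidable-stable (rel? π i j) λ ¬e → ∄ (i , j , ¬li , ¬lj , ¬e)) u≰1

    lam-star : ∀ πX → inΠᵇ πX π ≡ true → unlabBlocks π ≤ 1 → lam μ πX π ≡ μ π (star π)
    lam-star πX π∈ u≤1 = trans (lam-sum πX π∈) (Sum-oneLabelled-star (to (unlabBlocks≤1⇔ vπ) u≤1))

theorem6p11 : (n : ℕ) (μ : Raw n → Raw n → ℤ) → IsMobius μ →
    (πX : Raw n) → valid πX ≡ true → singletons πX →
    (∀ π → inΠᵇ πX π ≡ true → (¬ (lam μ πX π ≡ 0ℤ) → unlabBlocks π ≤ 1) × (unlabBlocks π ≤ 1 → ¬ (lam μ πX π ≡ 0ℤ)))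
    × (∀ π → inΠᵇ πX π ≡ true → ¬ (lam μ πX π ≡ 0ℤ) → lam μ πX π ≡ μ π (star π))
theorem6p11 n μ isμ πX _ _ =
  (λ π π∈ → atMostOne π π∈ , λ u≤1 λ≡0 →
     μ-star-nonzero (valid-π π∈) (trans (sym (lam-star (valid-π π∈) πX π∈ u≤1)) λ≡0))
  , λ π π∈ λ≢0 → lam-star (valid-π π∈) πX π∈ (atMostOne π π∈ λ≢0)
  where
  open Mobius isμ
  valid-π : ∀ {π} → inΠᵇ πX π ≡ true → Valid π
  valid-π π∈ = to valid⇔ (∧-conicalˡ _ _ π∈)
  atMostOne : ∀ π → inΠᵇ πX π ≡ true → ¬ (lam μ πX π ≡ 0ℤ) → unlabBlocks π ≤ 1
  atMostOne π π∈ λ≢0 = decidable-stable (unlabBlocks π ℕ.≤? 1) λ u≰1 → λ≢0 (lam-zero (valid-π π∈) πX π∈ u≰1)
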